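{- Every connected split graph $G$ (finite, simple, undirected, with $n \ge 2$ vertices) is well-burnable, i.e. $b(G) \leq \lceil \sqrt{n}\, \rceil$.
   Context: A split graph is a graph whose vertex set can be partitioned into a clique (a set of mutually adjacent vertices) and an independent set (a set of mutually non-adjacent vertices). Graph burning: initially all vertices of a finite simple undirected graph $G$ are unburned. The process runs in rounds $t = 1, 2, 3, \dots$. In round $t$, a vertex $x_t$ that is not burned at the end of round $t-1$ is chosen as a new source of fire and becomes burned; simultaneously, every vertex adjacent to a vertex that was burned at the end of round $t-1$ becomes burned. Burned vertices remain burned. The process ends at the first round after which all vertices of $G$ are burned. The burning number $b(G)$ is the minimum, over all choices of sources, of the number of rounds needed to burn all vertices of $G$. A connected graph $G$ on $n$ vertices is called well-burnable if $b(G) \leq \lceil \sqrt{n}\, \rceil$. -}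

module Defs where

open import Data.Fin using (Fin)
open import Data.Fin.Properties using (any?; all?; ¬∀⟶∃¬)
open import Data.Fin.Subset using (Subset; ⊥; ⁅_⁆; ∁; _∪_; _∈_; _∉_; _⊂_; ∣_∣)
open import Data.Fin.Subset.Properties using (_∈?_; p⊆p∪q; q⊆p∪q; x∈⁅x⁆; p⊂q⇒∣p∣<∣q∣; ∣p∣≤n)
open import Data.Nat using (ℕ; zero; suc; _+_; _*_; _≤_; _<_; _≤?_; z≤n; s≤s)
open import Data.Nat.Properties using (≤-trans; m≤m+n; +-monoʳ-<; <⇒≱)
open import Data.Product using (∃; _×_; _,_; proj₁; proj₂)
open import Data.Vec using (tabulate)
open import Level using (0ℓ)
open import Relation.Binary using (Rel; Symmetric; Irreflexive)
import Relation.Binary.Definitions as Binary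
open import Relation.Binary.Construct.Closure.ReflexiveTransitive using (Star)
open import Relation.Binary.PropositionalEquality using (_≡_; _≢_)
open import Relation.Nullary using (yes; no; ¬_; does; contradiction; ¬?; _×-dec_; map′)
open import Relation.Unary using (Pred; Decidable)

Least : Pred ℕ 0ℓ → Pred ℕ 0ℓ
Least P m = P m × (∀ k → P k → m ≤ k)

least : {P : Pred ℕ 0ℓ} → Decidable P → ∀ m → P m → ∃ (Least P)
least         P? zero    p = zero , p , λ _ _ → z≤n
least {P = P} P? (suc m) p with P? zero
... | yes p₀ = zero , p₀ , λ _ _ → z≤n
... | no ¬p₀ with least {P = λ k → P (suc k)} (λ k → P? (suc k)) m p
...   | l , pl , min = suc l , pl , λ where
        zero    p₀ → contradiction p₀ ¬p₀
        (suc k) pk → s≤s (min k pk)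

n≤n*n : ∀ n → n ≤ n * n
n≤n*n zero    = z≤n
n≤n*n (suc n) = m≤m+n (suc n) (n * suc n)

ceilSqrt : ∀ n → ∃ (Least (λ s → n ≤ s * s))
ceilSqrt n = least (λ s → n ≤? s * s) n (n≤n*n n)

-- ⌈√n⌉ is the least integer s ≥ √n, and for a natural number s,
-- √n ≤ s means n ≤ s².
⌈√_⌉ : ℕ → ℕ
⌈√ n ⌉ = proj₁ (ceilSqrt n)

-- Adjacency is required to be decidable; classically this is no restriction.
record Graph (n : ℕ) : Set₁ where
  field
    Adj    : Rel (Fin n) 0ℓ
    sym    : Symmetric Adj
    irrefl : Irreflexive _≡_ Adj
    adj?   : Binary.Decidable Adj

Connected : ∀ {n} → Graph n → Set
Connected G = ∀ u v → Star (Graph.Adj G) u v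

IsClique : ∀ {n} → Graph n → Subset n → Set
IsClique G K = ∀ u v → u ∈ K → v ∈ K → u ≢ v → Graph.Adj G u v

IsIndependent : ∀ {n} → Graph n → Subset n → Set
IsIndependent G I = ∀ u v → u ∈ I → v ∈ I → ¬ Graph.Adj G u v

IsSplit : ∀ {n} → Graph n → Set
IsSplit G = ∃ λ K → IsClique G K × IsIndependent G (∁ K)

neighbours : ∀ {n} → Graph n → Subset n → Subset n
neighbours G B = tabulate λ v → does (any? λ u → u ∈? B ×-dec Graph.adj? G u v)

-- If B is the set of vertices burned at the end of some round, then
-- nextBurned G B x is the set burned at the end of the following round, in
-- which x is the new source. Fire spreads from B only, not yet from x.
nextBurned : ∀ {n} → Graph n → Subset n → Fin n → Subset n
nextBurned G B x = B ∪ (⁅ x ⁆ ∪ neighbours G B)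

-- BurnsFrom G B k: starting from the set B of burned vertices, the process
-- can end after exactly k further rounds. Since every round needs an unburned
-- source, the process cannot go on once all vertices are burned.
data BurnsFrom {n} (G : Graph n) (B : Subset n) : ℕ → Set where
  done  : (∀ v → v ∈ B) → BurnsFrom G B zero
  round : ∀ {k} x → x ∉ B → BurnsFrom G (nextBurned G B x) k → BurnsFrom G B (suc k)

BurnsIn : ∀ {n} → Graph n → ℕ → Set
BurnsIn G = BurnsFrom G ⊥

burnsFrom? : ∀ {n} (G : Graph n) B → Decidable (BurnsFrom G B)
burnsFrom? G B zero    = map′ done (λ { (done b) → b }) (all? (_∈? B))
burnsFrom? G B (suc k) =
  map′ (λ { (x , x∉B , p) → round x x∉B p })
       (λ { (round x x∉B p) → x , x∉B , p })
       (any? λ x → ¬? (x ∈? B) ×-dec burnsFrom? G (nextBurned G B x) k)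

⊂-nextBurned : ∀ {n} (G : Graph n) {B x} → x ∉ B → B ⊂ nextBurned G B x
⊂-nextBurned G {B} {x} x∉B =
  p⊆p∪q _ , x , q⊆p∪q B _ (p⊆p∪q (neighbours G B) (x∈⁅x⁆ x)) , x∉B

someBurnsFrom : ∀ {n} (G : Graph n) B fuel → n ≤ fuel + ∣ B ∣ → ∃ (BurnsFrom G B)
someBurnsFrom {n} G B fuel n≤ with all? (_∈? B)
... | yes all = zero , done all
... | no ¬all with ¬∀⟶∃¬ n (_∈ B) (_∈? B) ¬all
...   | x , x∉B = go fuel n≤
  where
  grows : ∣ B ∣ < ∣ nextBurned G B x ∣
  grows = p⊂q⇒∣p∣<∣q∣ (⊂-nextBurned G x∉B)

  go : ∀ f → n ≤ f + ∣ B ∣ → ∃ (BurnsFrom G B)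
  go zero    n≤∣B∣ =
    contradiction (≤-trans (∣p∣≤n (nextBurned G B x)) n≤∣B∣) (<⇒≱ grows)
  go (suc f) n≤1+f+∣B∣ with someBurnsFrom G (nextBurned G B x) f
    (≤-trans n≤1+f+∣B∣ (+-monoʳ-< f grows))
  ... | k , p = suc k , round x x∉B p

leastBurning : ∀ {n} (G : Graph n) → ∃ (Least (BurnsIn G))
leastBurning {n} G = least (burnsFrom? G ⊥) (proj₁ some) (proj₂ some)
  where
  some : ∃ (BurnsIn G)
  some = someBurnsFrom G ⊥ n (m≤m+n n _)

burningNumber : ∀ {n} → Graph n → ℕ
burningNumber G = proj₁ (leastBurning G)

WellBurnable : ∀ {n} → Graph n → Set
WellBurnable {n} G = burningNumber G ≤ ⌈√ n ⌉

{-# OPTIONS --safe #-}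

-- Every vertex of a connected split graph is within distance 2 of every clique
-- vertex, so three rounds suffice; this settles n ≥ 5. For n ≤ 4 two rounds are
-- needed: either n = 2, or some vertex has two neighbours, and then at most
-- one vertex is left for the second source.

module Submission where

open import Defs
open import Data.Fin using (Fin; zero; suc)
open import Data.Fin.Properties using (any?; all?; ¬∀⟶∃¬; injective⇒≤; _≟_)
open import Data.Fin.Subset using (Subset; ⊥; _∈_; _∉_)
open import Data.Fin.Subset.Properties
  using (_∈?_; ∉⊥; x∈⁅x⁆; x∈⁅y⁆⇒x≡y; x∈p∪q⁺; x∈p∪q⁻; x∉p⇒x∈∁p)
open import Data.Nat using (ℕ; _*_; _≤_; _<_; z≤n; s≤s; _≤?_)
open import Data.Nat.Properties using (≤-trans; ≰⇒>; *-mono-≤; <⇒≱)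
open import Data.Product using (∃; ∃₂; _×_; _,_; proj₁; proj₂)
open import Data.Sum using (_⊎_; inj₁; inj₂)
open import Data.Vec using (Vec; []; _∷_)
open import Data.Vec.Relation.Unary.All using ([]; _∷_)
open import Data.Vec.Relation.Unary.AllPairs using ([]; _∷_)
open import Data.Vec.Relation.Unary.Unique.Propositional using (Unique)
open import Data.Vec.Relation.Unary.Unique.Propositional.Properties using (lookup-injective)
open import Data.Vec.Properties using ([]=⇒lookup; lookup⇒[]=; lookup∘tabulate)
open import Function using (_∘_)
open import Level using (0ℓ)
open import Relation.Binary using (Rel)
open import Relation.Binary.Construct.Closure.ReflexiveTransitive using (Star; ε; _◅_)
open import Relation.Binary.PropositionalEquality using (_≡_; _≢_; refl; sym; trans; ≢-sym)
open import Relation.Nullary using (yes; no; ¬_; contradiction; _×-dec_; _⊎-dec_)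
open import Relation.Nullary.Decidable using (dec-true)
open import Relation.Unary using (Pred; Decidable)

unique⇒length≤ : ∀ {m n} {xs : Vec (Fin n) m} → Unique xs → m ≤ n
unique⇒length≤ xs! = injective⇒≤ (lookup-injective xs! _ _)

-- Induction along the path: the first step that leaves `P` is the edge sought. Applied below to
-- vertex sets with one and with two elements.
crossing : ∀ {A : Set} {R : Rel A 0ℓ} {P : Pred A 0ℓ} → Decidable P →
           ∀ {u v} → Star R u v → P u → ¬ P v →
           ∃₂ λ a b → P a × ¬ P b × R a b
crossing P? ε pu ¬pv = contradiction pu ¬pv
crossing P? (_◅_ {u} {w} r path) pu ¬pv with P? w
... | yes pw = crossing P? path pw ¬pv
... | no ¬pw = u , w , pu , ¬pw , r

-- If `⌈√ n ⌉ ≤ k`, squaring would give `n ≤ k * k`. This turns a lower bound on `n` into a number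
-- of rounds that are available.
<⌈√⌉ : ∀ {n} k → k * k < n → k < ⌈√ n ⌉
<⌈√⌉ {n} k k²<n = ≰⇒> λ √n≤k →
  <⇒≱ k²<n (≤-trans (proj₁ (proj₂ (ceilSqrt n))) (*-mono-≤ √n≤k √n≤k))

module _ {n} (G : Graph n) where

  open Graph G renaming (sym to adj-sym)

  ∈-neighbours⁺ : ∀ {B u v} → u ∈ B → Adj u v → v ∈ neighbours G B
  ∈-neighbours⁺ {B} {u} {v} u∈B uv =
    lookup⇒[]= v _ (trans (lookup∘tabulate _ v) (dec-true (any? _) (u , u∈B , uv)))

  ∈-neighbours⁻ : ∀ {B v} → v ∈ neighbours G B → ∃ λ u → u ∈ B × Adj u v
  ∈-neighbours⁻ {B} {v} v∈N
    with any? (λ u → u ∈? B ×-dec adj? u v)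
       | trans (sym (lookup∘tabulate _ v)) ([]=⇒lookup v∈N)
  ... | yes found | _ = found
  ... | no _      | ()

  ∈-nextBurned-burned : ∀ {B x v} → v ∈ B → v ∈ nextBurned G B x
  ∈-nextBurned-burned v∈B = x∈p∪q⁺ (inj₁ v∈B)

  ∈-nextBurned-source : ∀ {B x} → x ∈ nextBurned G B x
  ∈-nextBurned-source {B} {x} = x∈p∪q⁺ {p = B} (inj₂ (x∈p∪q⁺ (inj₁ (x∈⁅x⁆ x))))

  ∈-nextBurned-spread : ∀ {B x u v} → u ∈ B → Adj u v → v ∈ nextBurned G B x
  ∈-nextBurned-spread {B} u∈B uv =
    x∈p∪q⁺ {p = B} (inj₂ (x∈p∪q⁺ (inj₂ (∈-neighbours⁺ u∈B uv))))

  -- `⊥` has no neighbours, so only the source burns in round one. Hence every vertex other than `c`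
  -- is a legal second source.
  ∈-firstBurned⁻ : ∀ {c v} → v ∈ nextBurned G ⊥ c → v ≡ c
  ∈-firstBurned⁻ v∈ with x∈p∪q⁻ ⊥ _ v∈
  ... | inj₁ v∈⊥ = contradiction v∈⊥ ∉⊥
  ... | inj₂ v∈′ with x∈p∪q⁻ _ (neighbours G ⊥) v∈′
  ...   | inj₁ v∈⁅c⁆ = x∈⁅y⁆⇒x≡y _ v∈⁅c⁆
  ...   | inj₂ v∈N   = contradiction (proj₁ (proj₂ (∈-neighbours⁻ v∈N))) ∉⊥

  adj⇒≢ : ∀ {u v} → Adj u v → u ≢ v
  adj⇒≢ uv u≡v = irrefl u≡v uv

  burningNumber≤ : ∀ {k} → BurnsIn G k → burningNumber G ≤ k
  burningNumber≤ = proj₂ (proj₂ (leastBurning G)) _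

  allOrMissing : ∀ (B : Subset n) → (∀ v → v ∈ B) ⊎ ∃ (_∉ B)
  allOrMissing B with all? (_∈? B)
  ... | yes all = inj₁ all
  ... | no ¬all = inj₂ (¬∀⟶∃¬ n (_∈ B) (_∈? B) ¬all)

  burnedInTwo : ∀ {c x} → x ≢ c → (∀ v → v ∈ nextBurned G (nextBurned G ⊥ c) x) →
                burningNumber G ≤ 2
  burnedInTwo {c} {x} x≢c all =
    burningNumber≤ (round c ∉⊥ (round x (x≢c ∘ ∈-firstBurned⁻) (done all)))

  edge : 2 ≤ n → Connected G → ∃₂ Adj
  edge (s≤s (s≤s _)) conn
    with a , b , _ , _ , ab ← crossing (_≟ zero) (conn zero (suc zero)) refl (λ ())
    = a , b , ab

  Radius≤2 : Fin n → Set
  Radius≤2 c = ∀ v → v ≡ c ⊎ Adj c v ⊎ ∃ λ w → Adj c w × Adj w v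

  -- The fire from `c` alone covers distance 2 by the end of round three, so the later sources only
  -- have to be unburned when chosen. The neighbour `y` is a legal choice for round two.
  radius≤2⇒burningNumber≤3 : ∀ {c y} → Adj c y → Radius≤2 c → burningNumber G ≤ 3
  radius≤2⇒burningNumber≤3 {c} {y} cy near with allOrMissing (nextBurned G (nextBurned G ⊥ c) y)
  -- No third source exists here: the process is already over after two rounds.
  ... | inj₁ all = ≤-trans (burnedInTwo (≢-sym (adj⇒≢ cy)) all) (s≤s (s≤s z≤n))
  ... | inj₂ (x , x∉B₂) =
    burningNumber≤ (round c ∉⊥ (round y y∉B₁ (round x x∉B₂ (done (burned ∘ near)))))
    where
    c∈B₁ = ∈-nextBurned-source {B = ⊥}
    y∉B₁ = ≢-sym (adj⇒≢ cy) ∘ ∈-firstBurned⁻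

    burned : ∀ {v} → v ≡ c ⊎ Adj c v ⊎ (∃ λ w → Adj c w × Adj w v) →
             v ∈ nextBurned G (nextBurned G (nextBurned G ⊥ c) y) x
    burned (inj₁ refl) = ∈-nextBurned-burned (∈-nextBurned-burned c∈B₁)
    burned (inj₂ (inj₁ cv)) = ∈-nextBurned-burned (∈-nextBurned-spread c∈B₁ cv)
    burned (inj₂ (inj₂ (w , cw , wv))) =
      ∈-nextBurned-spread (∈-nextBurned-spread c∈B₁ cw) wv

  -- Take `v` outside `K` and the first step of a path from `v` to `c`. Its endpoint lies in `K` by
  -- independence of the complement, so it equals `c` or is adjacent to it.
  cliqueVertex-radius≤2 : Connected G → ((K , _) : IsSplit G) → ∀ {c} → c ∈ K → Radius≤2 c
  cliqueVertex-radius≤2 conn (K , clique , indep) {c} c∈K v with v ≟ c | v ∈? K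
  ... | yes v≡c | _       = inj₁ v≡c
  ... | no v≢c  | yes v∈K = inj₂ (inj₁ (clique c v c∈K v∈K (≢-sym v≢c)))
  ... | no v≢c  | no v∉K with conn v c
  ...   | ε = contradiction refl v≢c
  ...   | _◅_ {j = w} vw _ with w ≟ c | w ∈? K
  ...     | yes refl | _       = inj₂ (inj₁ (adj-sym vw))
  ...     | no w≢c   | yes w∈K =
    inj₂ (inj₂ (w , clique c w c∈K w∈K (≢-sym w≢c) , adj-sym vw))
  ...     | no _     | no w∉K  =
    contradiction vw (indep v w (x∉p⇒x∈∁p v∉K) (x∉p⇒x∈∁p w∉K))

  split⇒burningNumber≤3 : 2 ≤ n → Connected G → IsSplit G → burningNumber G ≤ 3
  split⇒burningNumber≤3 2≤n conn split@(K , _ , indep)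
    -- Any edge has an endpoint in `K`; that endpoint becomes the centre and the other one its
    -- neighbour.
    with x , y , xy ← edge 2≤n conn
    with x ∈? K | y ∈? K
  ... | yes x∈K | _       = radius≤2⇒burningNumber≤3 xy (cliqueVertex-radius≤2 conn split x∈K)
  ... | no _    | yes y∈K =
    radius≤2⇒burningNumber≤3 (adj-sym xy) (cliqueVertex-radius≤2 conn split y∈K)
  ... | no x∉K  | no y∉K  =
    contradiction xy (indep x y (x∉p⇒x∈∁p x∉K) (x∉p⇒x∈∁p y∉K))

  -- Two rounds starting at `c` burn `c`, `a` and `b` whatever the second source is. With at most
  -- four vertices, one more at most remains, and it can be the second source.
  cherry⇒burningNumber≤2 : n ≤ 4 → ∀ {c a b} → Adj c a → Adj c b → a ≢ b → burningNumber G ≤ 2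
  -- The source `a` would catch fire from `c` anyway, so a vertex `d` missed here is neither `c` nor
  -- a neighbour of `c`.
  cherry⇒burningNumber≤2 n≤4 {c} {a} {b} ca cb a≢b with allOrMissing (nextBurned G (nextBurned G ⊥ c) a)
  ... | inj₁ all = burnedInTwo (≢-sym (adj⇒≢ ca)) all
  ... | inj₂ (d , d∉) with allOrMissing (nextBurned G (nextBurned G ⊥ c) d)
  ...   | inj₁ all =
    burnedInTwo (λ { refl → d∉ (∈-nextBurned-burned (∈-nextBurned-source {B = ⊥})) }) all
  ...   | inj₂ (e , e∉) = contradiction (unique⇒length≤ distinct) (<⇒≱ (s≤s n≤4))
    where
    c∈B₁ = ∈-nextBurned-source {B = ⊥} {c}

    outside : ∀ {x v} → v ∉ nextBurned G (nextBurned G ⊥ c) x →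
              c ≢ v × (∀ {w} → Adj c w → w ≢ v)
    outside v∉ = (λ { refl → v∉ (∈-nextBurned-burned c∈B₁) })
               , (λ { cw refl → v∉ (∈-nextBurned-spread c∈B₁ cw) })

    d≢e : d ≢ e
    d≢e refl = e∉ (∈-nextBurned-source {B = nextBurned G ⊥ c})

    distinct : Unique (c ∷ a ∷ b ∷ d ∷ e ∷ [])
    distinct
      = (adj⇒≢ ca ∷ adj⇒≢ cb ∷ proj₁ (outside d∉) ∷ proj₁ (outside e∉) ∷ [])
      ∷ (a≢b ∷ proj₂ (outside d∉) ca ∷ proj₂ (outside e∉) ca ∷ [])
      ∷ (proj₂ (outside d∉) cb ∷ proj₂ (outside e∉) cb ∷ [])
      ∷ (d≢e ∷ [])
      ∷ [] ∷ []

  connected⇒burningNumber≤2 : 2 ≤ n → n ≤ 4 → Connected G → burningNumber G ≤ 2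
  connected⇒burningNumber≤2 2≤n n≤4 conn
    with x , y , xy ← edge 2≤n conn
    with allOrMissing (nextBurned G (nextBurned G ⊥ x) y)
  ... | inj₁ all = burnedInTwo (≢-sym (adj⇒≢ xy)) all
  ... | inj₂ (z , z∉)
    -- The path from `x` to the unburned `z` leaves the pair `x`, `y`. The edge on which it does so
    -- shares one endpoint with `xy`, which gives that endpoint two distinct neighbours.
    with crossing (λ v → v ≟ x ⊎-dec v ≟ y) (conn x z) (inj₁ refl)
           (λ { (inj₁ refl) → z∉ (∈-nextBurned-burned (∈-nextBurned-source {B = ⊥}))
              ; (inj₂ refl) → z∉ (∈-nextBurned-source {B = nextBurned G ⊥ x}) })
  ...   | _ , w , inj₁ refl , w∉ , xw = cherry⇒burningNumber≤2 n≤4 xy xw (w∉ ∘ inj₂ ∘ sym)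
  ...   | _ , w , inj₂ refl , w∉ , yw =
    cherry⇒burningNumber≤2 n≤4 (adj-sym xy) yw (w∉ ∘ inj₁ ∘ sym)

mainTheorem3 : ∀ (n : ℕ) → 2 ≤ n → (G : Graph n) → Connected G → IsSplit G → WellBurnable G
mainTheorem3 n 2≤n G conn split with n ≤? 4
-- Here `1 * 1 < n` allows two rounds; in the other case `2 * 2 < n` allows three.
... | yes n≤4 = ≤-trans (connected⇒burningNumber≤2 G 2≤n n≤4 conn) (<⌈√⌉ 1 2≤n)
... | no  n≰4 = ≤-trans (split⇒burningNumber≤3 G 2≤n conn split) (<⌈√⌉ 2 (≰⇒> n≰4))
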